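{- Let $k\ge 1$ and $0\le i\le k-1$ be integers. Then for every integer $n\ge 0$, $$\sum_{j=0}^{2k+1} P_k^i(n+j) = 4\,P_k^i(n+2k).$$
   Context: For integers $k\ge 1$ and $0\le i\le k-1$, the generalized Pell $(k,i)$-numbers $P_k^i(n)$, $n\ge 0$, are defined by $P_k^i(0)=P_k^i(1)=\cdots=P_k^i(i)=0$, $P_k^i(i+1)=P_k^i(i+2)=\cdots=P_k^i(k)=1$, and $P_k^i(n)=2P_k^i(n-1)+P_k^i(n-k-1)$ for $n\ge k+1$. -}

module Defs where

open import Data.Nat using (ℕ; zero; suc; _+_; _*_; _∸_; _≤_; _<_; _≤?_; s≤s)
open import Data.Nat.Properties using (≤-refl; ≤-trans; m∸n≤m; <⇒≱; +-comm; ∸-+-assoc)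
open import Data.Nat.Induction using (Acc; acc; <-wellFounded)
open import Relation.Nullary using (yes; no; contradiction)
open import Relation.Binary.PropositionalEquality using (_≡_; refl; cong₂)

-- In the last case suc m ≥ k + 1, so m and m ∸ k are the indices
-- n - 1 and n - k - 1 (no truncation) for n = suc m.
pellAcc : (k i n : ℕ) → Acc _<_ n → ℕ
pellAcc k i zero    _        = 0
pellAcc k i (suc m) (acc rs) with suc m ≤? i | suc m ≤? k
... | yes _ | _     = 0
... | no _  | yes _ = 1
... | no _  | no _  = 2 * pellAcc k i m (rs ≤-refl)
                        + pellAcc k i (m ∸ k) (rs (s≤s (m∸n≤m m k)))

-- P k i n is P_k^i(n).  It is total in k and i; it is the sequence of the
-- definition when 0 ≤ i ≤ k - 1, as P-zero, P-one and P-rec below verify.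
P : (k i n : ℕ) → ℕ
P k i n = pellAcc k i n (<-wellFounded n)

pellAcc-irrelevant : ∀ k i n (a b : Acc _<_ n) → pellAcc k i n a ≡ pellAcc k i n b
pellAcc-irrelevant k i zero    _        _        = refl
pellAcc-irrelevant k i (suc m) (acc rs) (acc ss) with suc m ≤? i | suc m ≤? k
... | yes _ | _     = refl
... | no _  | yes _ = refl
... | no _  | no _  = cong₂ (λ x y → 2 * x + y)
                        (pellAcc-irrelevant k i m _ _)
                        (pellAcc-irrelevant k i (m ∸ k) _ _)

P-zero : ∀ k i n → n ≤ i → P k i n ≡ 0
P-zero k i zero    _   = refl
P-zero k i (suc m) n≤i with <-wellFounded (suc m)
... | acc rs with suc m ≤? i | suc m ≤? k
... | yes _   | _ = refl
... | no  n≰i | _ = contradiction n≤i n≰i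

P-one : ∀ k i n → i < n → n ≤ k → P k i n ≡ 1
P-one k i (suc m) i<n n≤k with <-wellFounded (suc m)
... | acc rs with suc m ≤? i | suc m ≤? k
... | yes n≤i | _       = contradiction n≤i (<⇒≱ i<n)
... | no  _   | yes _   = refl
... | no  _   | no  n≰k = contradiction n≤k n≰k

P-rec : ∀ k i n → i ≤ k ∸ 1 → k + 1 ≤ n →
        P k i n ≡ 2 * P k i (n ∸ 1) + P k i (n ∸ k ∸ 1)
P-rec k i n i≤k-1 k+1≤n rewrite +-comm k 1 | ∸-+-assoc n k 1 | +-comm k 1 = go n k+1≤n
  where
  go : ∀ n → k < n → P k i n ≡ 2 * P k i (n ∸ 1) + P k i (n ∸ suc k)
  go (suc m) k<n with <-wellFounded (suc m)
  ... | acc rs with suc m ≤? i | suc m ≤? k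
  ... | yes n≤i | _       = contradiction (≤-trans n≤i (≤-trans i≤k-1 (m∸n≤m k 1))) (<⇒≱ k<n)
  ... | no  _   | yes n≤k = contradiction n≤k (<⇒≱ k<n)
  ... | no  _   | no  _   = cong₂ (λ x y → 2 * x + y)
                              (pellAcc-irrelevant k i m _ _)
                              (pellAcc-irrelevant k i (m ∸ k) _ _)

{-# OPTIONS --safe #-}
-- The recurrence g (k + 1 + j) = 2 g (k + j) + g j makes
-- g j + g (k + 1 + j) = 2 g (k + 1 + j) - 2 g (k + j) telescope.  Pairing the
-- terms at distance k + 1 in the 2k + 2 consecutive ones, their sum is
-- 2 g (2k + 1) - 2 g k, and one more use of the recurrence gives 4 g (2k).
module Submission where

open import Data.Nat using (ℕ; zero; suc; _+_; _*_; _∸_; _≤_)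
open import Data.Nat.Properties
  using (+-comm; +-assoc; +-identityʳ; +-suc; +-cancelʳ-≡; m≤m+n; m+n∸m≡n; ≤-reflexive; ≤-trans)
open import Data.Nat.Tactic.RingSolver using (solve-∀)
open import Data.List using (map; upTo; applyUpTo)
open import Data.List.Properties using (map-upTo)
open import Data.Nat.ListAction using (sum)
open import Relation.Binary.PropositionalEquality using (_≡_; refl; sym; trans; cong; cong₂; module ≡-Reasoning)
open import Function using (_∘_)
open import Defs

open ≡-Reasoning

sum-applyUpTo-+ : ∀ (g : ℕ → ℕ) m n →
  sum (applyUpTo g (m + n)) ≡ sum (applyUpTo g m) + sum (applyUpTo (g ∘ (m +_)) n)
sum-applyUpTo-+ g zero    n = refl
sum-applyUpTo-+ g (suc m) n =
  trans (cong (g 0 +_) (sum-applyUpTo-+ (g ∘ suc) m n)) (sym (+-assoc (g 0) _ _))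

-- `applyUpTo` unfolds from the front, whereas the induction in `sum-pairs` appends a last term.
sum-applyUpTo-suc : ∀ (g : ℕ → ℕ) m →
  sum (applyUpTo g (suc m)) ≡ sum (applyUpTo g m) + g m
sum-applyUpTo-suc g zero    = +-identityʳ (g 0)
sum-applyUpTo-suc g (suc m) =
  trans (cong (g 0 +_) (sum-applyUpTo-suc (g ∘ suc) m)) (sym (+-assoc (g 0) _ _))

-- Stated for any `g` with the recurrence, so that it applies to the shifted sequence
-- `P k i (n + j)` in `j` and the offset `n` stays out of the sums.
module PellRecurrence (k : ℕ) (g : ℕ → ℕ) (rec : ∀ j → g (suc k + j) ≡ 2 * g (k + j) + g j) where

  -- The lower end `2 * g k` of the telescoping sum is added on the left, which avoids truncated
  -- subtraction.
  sum-pairs : ∀ m →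
    sum (applyUpTo g m) + sum (applyUpTo (g ∘ (suc k +_)) m) + 2 * g k ≡ 2 * g (k + m)
  sum-pairs zero    = cong ((2 *_) ∘ g) (sym (+-identityʳ k))
  sum-pairs (suc m) = begin
    sum (applyUpTo g (suc m)) + sum (applyUpTo h (suc m)) + 2 * g k
      ≡⟨ cong (_+ 2 * g k) (cong₂ _+_ (sum-applyUpTo-suc g m) (sum-applyUpTo-suc h m)) ⟩
    (a + g m) + (b + h m) + 2 * g k  ≡⟨ regroup a (g m) b (h m) (2 * g k) ⟩
    (a + b + 2 * g k) + g m + h m    ≡⟨ cong (λ s → s + g m + h m) (sum-pairs m) ⟩
    -- The recurrence, read from right to left, absorbs `2 * g (k + m) + g m` into a second copy of
    -- `h m`.
    2 * g (k + m) + g m + h m        ≡⟨ cong (_+ h m) (rec m) ⟨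
    h m + h m                        ≡⟨ cong (h m +_) (+-identityʳ (h m)) ⟨
    2 * h m                          ≡⟨ cong ((2 *_) ∘ g) (+-suc k m) ⟨
    2 * g (k + suc m)                ∎
    where
    h = g ∘ (suc k +_)
    a = sum (applyUpTo g m)
    b = sum (applyUpTo h m)
    regroup : ∀ a x b y c → (a + x) + (b + y) + c ≡ (a + b + c) + x + y
    regroup = solve-∀

  sum-double : sum (applyUpTo g (suc k + suc k)) ≡ 4 * g (k + k)
  -- With `2 * g k` added to both sides, `sum-pairs` applies at `m = suc k`, and `rec k` then
  -- reproduces the same `2 * g k` on the right.
  sum-double = +-cancelʳ-≡ (2 * g k) _ _ (begin
    sum (applyUpTo g (suc k + suc k)) + 2 * g k
      ≡⟨ cong (_+ 2 * g k) (sum-applyUpTo-+ g (suc k) (suc k)) ⟩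
    sum (applyUpTo g (suc k)) + sum (applyUpTo (g ∘ (suc k +_)) (suc k)) + 2 * g k
      ≡⟨ sum-pairs (suc k) ⟩
    2 * g (k + suc k)                ≡⟨ cong ((2 *_) ∘ g) (+-suc k k) ⟩
    2 * g (suc k + k)                ≡⟨ cong (2 *_) (rec k) ⟩
    2 * (2 * g (k + k) + g k)        ≡⟨ expand (g (k + k)) (g k) ⟩
    4 * g (k + k) + 2 * g k          ∎)
    where
    expand : ∀ x y → 2 * (2 * x + y) ≡ 4 * x + 2 * y
    expand = solve-∀

-- Restates `P-rec` without subtraction: at index `suc k + m` nothing is truncated.
P-shift : ∀ k i → i ≤ k ∸ 1 → ∀ m → P k i (suc k + m) ≡ 2 * P k i (k + m) + P k i m
P-shift k i i≤k-1 m = trans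
  (P-rec k i (suc k + m) i≤k-1 (≤-trans (≤-reflexive (+-comm k 1)) (m≤m+n (suc k) m)))
  (cong (λ x → 2 * P k i (k + m) + P k i x) index)
  where
  index : suc k + m ∸ k ∸ 1 ≡ m
  -- Moving the successor onto `m` lets `∸ k` cancel `k` exactly, leaving `suc m ∸ 1`.
  index = trans (cong (λ x → x ∸ k ∸ 1) (sym (+-suc k m))) (cong (_∸ 1) (m+n∸m≡n k (suc m)))

theorem7p4 : (k i : ℕ) → 1 ≤ k → i ≤ k ∸ 1 → (n : ℕ) →
    sum (map (λ j → P k i (n + j)) (upTo (suc (2 * k + 1)))) ≡ 4 * P k i (n + 2 * k)
theorem7p4 k i _ i≤k-1 n = begin
  sum (map g (upTo (suc (2 * k + 1))))     ≡⟨ cong sum (map-upTo g (suc (2 * k + 1))) ⟩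
  -- The `2k + 2` summands form two blocks of length `k + 1`.
  sum (applyUpTo g (suc (2 * k + 1)))      ≡⟨ cong (sum ∘ applyUpTo g) (length-eq k) ⟩
  sum (applyUpTo g (suc k + suc k))        ≡⟨ PellRecurrence.sum-double k g g-rec ⟩
  4 * g (k + k)                            ≡⟨ cong (λ x → 4 * g (k + x)) (+-identityʳ k) ⟨
  4 * g (2 * k)                            ∎
  where
  g : ℕ → ℕ
  g j = P k i (n + j)
  length-eq : ∀ k → suc (2 * k + 1) ≡ suc k + suc k
  length-eq = solve-∀
  swap : ∀ a b c → a + (b + c) ≡ b + (a + c)
  swap = solve-∀
  -- The recurrence is invariant under translation: it is `P-shift` at `n + j`, with `swap` moving
  -- `n` past the offsets.
  g-rec : ∀ j → g (suc k + j) ≡ 2 * g (k + j) + g j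
  g-rec j = begin
    P k i (n + (suc k + j))                          ≡⟨ cong (P k i) (swap n (suc k) j) ⟩
    P k i (suc k + (n + j))                          ≡⟨ P-shift k i i≤k-1 (n + j) ⟩
    2 * P k i (k + (n + j)) + P k i (n + j)          ≡⟨ cong (λ x → 2 * P k i x + g j) (swap k n j) ⟩
    2 * g (k + j) + g j                              ∎
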